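{- Without $2$-coherence, the key equality in the standard proof that left adjoints preserve colimits may fail for wild adjunctions. Concretely, let $\mathcal E$, $\Lambda:\mathcal E\to\mathcal E$ and the evident adjunction $\Lambda\dashv\Lambda$ be as in the context. For every graph $\Gamma$, every $\Gamma$-shaped diagram $F$ in $\mathcal E$, every cocone $\mathcal K=(C,r,K)$ under $F$, and every edge $g:\Gamma_1(i,j)$, the equality (EDGE) of the context, taken with respect to this adjunction and $h:=\mathsf{id}_\ast$, is false.
   Context: Everything is inside Book HoTT; $p\cdot q$ is path concatenation, $\mathsf{ap}_f$ the action of $f$ on paths. Wild category: a type of objects, a family $\mathsf{hom}$ of types (not assumed sets), identities, composition $\circ$, unit laws (paths), and $\mathsf{assoc}(f,g,h):(f\circ g)\circ h=f\circ(g\circ h)$; no further coherence. Wild functor $F$: functions on objects and morphisms with paths $F_\circ(g,f):F(g)\circ F(f)=F(g\circ f)$ and $F_{\mathsf{id}}(X):\mathsf{id}_{F(X)}=F(\mathsf{id}_X)$. Wild adjunction $L\dashv R$: equivalences $\psi:\mathsf{hom}_{\mathcal D}(L(A),X)\simeq\mathsf{hom}_{\mathcal C}(A,R(X))$ with paths $\mathsf{nat}_{cod}(g,h):R(g)\circ\psi(h)=\psi(g\circ h)$ and $\mathsf{nat}_{dom}(f,h):\psi(h)\circ f=\psi(h\circ L(f))$. Write $\eta_\psi:\psi^{ -1}\circ\psi\sim\mathsf{id}$ and $\epsilon_\psi:\psi\circ\psi^{ -1}\sim\mathsf{id}$ for the (half-adjoint) equivalence data, and define $\widetilde{\mathsf{nat}}_{dom}(f,k):\psi^{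 -1}(k)\circ L(f)=\psi^{ -1}(k\circ f)$ as $$\eta_\psi(\psi^{ -1}(k)\circ L(f))^{ -1}\cdot\mathsf{ap}_{\psi^{ -1}}(\mathsf{nat}_{dom}(f,\psi^{ -1}(k)))^{ -1}\cdot\mathsf{ap}_{\psi^{ -1}}(\mathsf{ap}_{ -\circ f}(\epsilon_\psi(k))).$$ Graph: a type $\Gamma_0$ and types $\Gamma_1(i,j)$ of edges. Diagram $F$: objects $F_i$ and morphisms $F_{i,j,g}:\mathsf{hom}(F_i,F_j)$. Cocone $(C,r,K)$ under $F$: an object $C$, $r_i:\mathsf{hom}(F_i,C)$, $K_{i,j,g}:r_j\circ F_{i,j,g}=r_i$. Its image under a functor $L$ has third component $L(K_{i,j,g}):=L_\circ(r_j,F_{i,j,g})\cdot\mathsf{ap}_L(K_{i,j,g})$. The equality (EDGE), for $h:\mathsf{hom}_{\mathcal D}(L(C),Y)$ and an edge $g:\Gamma_1(i,j)$: with $Q_i:=\mathsf{ap}_{\psi^{ -1}}(\mathsf{nat}_{dom}(r_i,h))\cdot\eta_\psi(h\circ L(r_i)):\psi^{ -1}(\psi(h)\circ r_i)=h\circ L(r_i)$, $$\widetilde{\mathsf{nat}}_{dom}(F_{i,j,g},\psi(h)\circ r_j)\cdot\mathsf{ap}_{\psi^{ -1}}\big(\mathsf{assoc}(\psi(h),r_j,F_{i,j,g})\cdot\mathsf{ap}_{\psi(h)\circ- }(K_{i,j,g})\big)\cdot Q_i$$ $$=\ \mathsf{ap}_{ -\circ L(F_{i,j,g})}(Q_j)\cdot\mathsf{assoc}(h,L(r_j),L(F_{i,j,g}))\cdot\mathsf{ap}_{h\circ-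 }(L(K_{i,j,g})).$$ (In the standard proof, this is what is needed to identify, via the paths $Q_i$, the composite equivalence $\mathsf{hom}_{\mathcal D}(L(C),Y)\simeq\mathsf{hom}_{\mathcal C}(C,R(Y))\simeq\mathsf{lim}_i\mathsf{hom}_{\mathcal C}(F_i,R(Y))\simeq\mathsf{lim}_i\mathsf{hom}_{\mathcal D}(L(F_i),Y)$ with the canonical post-composition map.) The wild category $\mathcal E$: $\mathsf{Ob}(\mathcal E):=\mathbf 1$, $\mathsf{hom}(\ast,\ast):=S^1$, where $S^1$ is the circle with $\mathsf{base}$ and $\mathsf{loop}:\mathsf{base}=\mathsf{base}$. Fix a pointed equivalence of $(S^1,\mathsf{base})$ with the loop space of the Eilenberg–MacLane space $K(\mathbb Z,2)$; let $\bullet$ be the operation on $S^1$ obtained from path concatenation. Composition is $g\circ f:=f\bullet g$, the identity morphism is $\mathsf{base}$, and the unit and associativity laws come from those of path concatenation. For $\ell:S^1$ the map $x\mapsto x\bullet\ell$ is a pointed equivalence $(S^1,\mathsf{base})\to(S^1,\ell)$ (pointed by the unit law), and $\mathsf L_\ell:\ell=\ell$ denotes the image of $\mathsf{loop}$ under the induced map on loop spaces. The functor $\Lambda:\mathcal E\to\mathcal E$ is the identity on objects and morphisms (with trivial identity law) and $\Lambda_\circ(g,f):=\mathsf L_{g\circ f}$. The evident adjunction $\Lambda\dashv\Lambda$ has $\psi$ the identity equivalence and $\mathsf{nat}_{cod},\mathsf{nat}_{dom}$ given by $\mathsf{refl}$. -}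

{-# OPTIONS --without-K #-}

-- Plain Agda without axiom K has neither univalence nor higher inductive types.
-- The parts of Book HoTT that the statement lives in (univalence, the circle,
-- truncations) are therefore collected in the record `BookHoTT`, which the
-- theorem takes as a hypothesis.  `_≡_` is read as the identity type, `trans`
-- as path concatenation and `cong` as `ap`.

module Defs where

open import Level using (Level; Setω; 0ℓ; _⊔_) renaming (suc to lsuc)
open import Data.Nat.Base using (ℕ; zero; suc)
open import Data.Integer.Base using (ℤ) renaming (_+_ to _+ℤ_)
open import Data.Product.Base using (Σ; Σ-syntax; _×_; _,_; proj₁; proj₂)
open import Data.Unit.Base using (⊤; tt)
open import Function.Base using (id)
open import Function.Properties.Inverse.HalfAdjointEquivalence using (_≃_) public
open import Relation.Binary.PropositionalEquality using (_≡_; refl; sym; trans; cong; subst; dcong; trans-assoc; trans-reflʳ)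

private
  variable
    ℓ ℓ′ o h o′ h′ a b : Level

id≃ : (A : Set ℓ) → A ≃ A
id≃ A = record
  { to               = λ x → x
  ; from             = λ x → x
  ; left-inverse-of  = λ _ → refl
  ; right-inverse-of = λ _ → refl
  ; left-right       = λ _ → refl
  }

IsEquiv : {A : Set ℓ} {B : Set ℓ′} → (A → B) → Set (ℓ ⊔ ℓ′)
IsEquiv {A = A} {B = B} f = Σ[ e ∈ A ≃ B ] _≃_.to e ≡ f

idtoeqv : {A B : Set ℓ} → A ≡ B → A ≃ B
idtoeqv refl = id≃ _

Univalence : Setω
Univalence = ∀ {ℓ} (A B : Set ℓ) → IsEquiv (idtoeqv {A = A} {B = B})

IsContr : Set ℓ → Set ℓ
IsContr A = Σ[ c ∈ A ] (∀ x → c ≡ x)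

-- Truncation levels are shifted by two: IsOfHLevel (2 + n) means "n-type".
IsOfHLevel : ℕ → Set ℓ → Set ℓ
IsOfHLevel zero    A = IsContr A
IsOfHLevel (suc n) A = (x y : A) → IsOfHLevel n (x ≡ y)

-- The computation rule at `base` is a path here, a judgmental equality in
-- Book HoTT; the rule at `loop` is adjusted along it.
record Circle : Setω where
  field
    S¹       : Set
    base     : S¹
    loop     : base ≡ base
    ind      : ∀ {ℓ} (P : S¹ → Set ℓ) (b : P base) → subst P loop b ≡ b → ∀ x → P x
    ind-base : ∀ {ℓ} (P : S¹ → Set ℓ) (b : P base) (l : subst P loop b ≡ b) →
               ind P b l base ≡ b
    ind-loop : ∀ {ℓ} (P : S¹ → Set ℓ) (b : P base) (l : subst P loop b ≡ b) →
               trans (dcong (ind P b l) loop) (ind-base P b l)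
                 ≡ trans (cong (subst P loop) (ind-base P b l)) l

record Truncation : Setω where
  field
    ∥_∥[_]   : ∀ {ℓ} → Set ℓ → ℕ → Set ℓ
    ∣_∣      : ∀ {ℓ} {A : Set ℓ} {n} → A → ∥ A ∥[ n ]
    ∥∥-level : ∀ {ℓ} (A : Set ℓ) n → IsOfHLevel n ∥ A ∥[ n ]
    ∥∥-ind   : ∀ {ℓ ℓ′} {A : Set ℓ} {n} (P : ∥ A ∥[ n ] → Set ℓ′) →
               (∀ x → IsOfHLevel n (P x)) → (∀ a → P ∣ a ∣) → ∀ x → P x
    ∥∥-β     : ∀ {ℓ ℓ′} {A : Set ℓ} {n} (P : ∥ A ∥[ n ] → Set ℓ′)
               (t : ∀ x → IsOfHLevel n (P x)) (f : ∀ a → P ∣ a ∣) (a : A) →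
               ∥∥-ind P t f ∣ a ∣ ≡ f a

record BookHoTT : Setω where
  field
    univalence : Univalence
    circle     : Circle
    truncation : Truncation

Pointed : (ℓ : Level) → Set (lsuc ℓ)
Pointed ℓ = Σ (Set ℓ) id

Ω : Pointed ℓ → Pointed ℓ
Ω (A , x) = (x ≡ x) , refl

infix 4 _≃∙_

_≃∙_ : Pointed ℓ → Pointed ℓ′ → Set (ℓ ⊔ ℓ′)
(A , x) ≃∙ (B , y) = Σ[ e ∈ A ≃ B ] _≃_.to e x ≡ y

Ω-map : {A : Set ℓ} {B : Set ℓ′} {x : A} {y : B} (f : A → B) → f x ≡ y → x ≡ x → y ≡ y
Ω-map f f₀ p = trans (sym f₀) (trans (cong f p) f₀)

-- (K , k) is an Eilenberg–MacLane space K(ℤ,2): a 1-connected 2-type whose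
-- second homotopy group π₂ = ∥ Ω² ∥₀ is isomorphic to ℤ.  The group operation
-- of π₂ is determined by ∣p∣ · ∣q∣ = ∣p·q∣, so it suffices to require the
-- homomorphism law on such representatives.
record IsK⟨ℤ,2⟩ (T : Truncation) (K : Pointed ℓ) : Set ℓ where
  open Truncation T
  field
    connected : IsContr ∥ proj₁ K ∥[ 3 ]
    truncated : IsOfHLevel 4 (proj₁ K)
    π₂≃ℤ      : ∥ proj₁ (Ω (Ω K)) ∥[ 2 ] ≃ ℤ
    π₂-hom    : (p q : proj₁ (Ω (Ω K))) →
                _≃_.to π₂≃ℤ ∣ trans p q ∣ ≡ _≃_.to π₂≃ℤ ∣ p ∣ +ℤ _≃_.to π₂≃ℤ ∣ q ∣

record WildCat (o h : Level) : Set (lsuc (o ⊔ h)) where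
  infixr 9 _∘_
  field
    Ob    : Set o
    hom   : Ob → Ob → Set h
    idn   : (X : Ob) → hom X X
    _∘_   : ∀ {X Y Z} → hom Y Z → hom X Y → hom X Z
    unitˡ : ∀ {X Y} (f : hom X Y) → idn Y ∘ f ≡ f
    unitʳ : ∀ {X Y} (f : hom X Y) → f ∘ idn X ≡ f
    assoc : ∀ {W X Y Z} (f : hom Y Z) (g : hom X Y) (h : hom W X) →
            (f ∘ g) ∘ h ≡ f ∘ (g ∘ h)

record WildFunctor (C : WildCat o h) (D : WildCat o′ h′) : Set (o ⊔ h ⊔ o′ ⊔ h′) where
  private
    module C = WildCat C
    module D = WildCat D
  field
    F₀   : C.Ob → D.Ob
    F₁   : ∀ {X Y} → C.hom X Y → D.hom (F₀ X) (F₀ Y)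
    F-∘  : ∀ {X Y Z} (g : C.hom Y Z) (f : C.hom X Y) → F₁ g D.∘ F₁ f ≡ F₁ (g C.∘ f)
    F-id : ∀ X → D.idn (F₀ X) ≡ F₁ (C.idn X)

record WildAdjunction {C : WildCat o h} {D : WildCat o′ h′}
                      (L : WildFunctor C D) (R : WildFunctor D C)
                      : Set (o ⊔ h ⊔ o′ ⊔ h′) where
  private
    module C = WildCat C
    module D = WildCat D
    module L = WildFunctor L
    module R = WildFunctor R
  field
    equiv : ∀ A X → D.hom (L.F₀ A) X ≃ C.hom A (R.F₀ X)

  ψ : ∀ {A X} → D.hom (L.F₀ A) X → C.hom A (R.F₀ X)
  ψ = _≃_.to (equiv _ _)

  ψ⁻¹ : ∀ {A X} → C.hom A (R.F₀ X) → D.hom (L.F₀ A) X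
  ψ⁻¹ = _≃_.from (equiv _ _)

  η : ∀ {A X} (k : D.hom (L.F₀ A) X) → ψ⁻¹ (ψ k) ≡ k
  η = _≃_.left-inverse-of (equiv _ _)

  ε : ∀ {A X} (k : C.hom A (R.F₀ X)) → ψ (ψ⁻¹ k) ≡ k
  ε = _≃_.right-inverse-of (equiv _ _)

  field
    nat-cod : ∀ {A X Y} (g : D.hom X Y) (h : D.hom (L.F₀ A) X) →
              R.F₁ g C.∘ ψ h ≡ ψ (g D.∘ h)
    nat-dom : ∀ {A B X} (f : C.hom A B) (h : D.hom (L.F₀ B) X) →
              ψ h C.∘ f ≡ ψ (h D.∘ L.F₁ f)

  nat-dom~ : ∀ {A B X} (f : C.hom A B) (k : C.hom B (R.F₀ X)) →
             ψ⁻¹ k D.∘ L.F₁ f ≡ ψ⁻¹ (k C.∘ f)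
  nat-dom~ f k =
    trans (sym (η (ψ⁻¹ k D.∘ L.F₁ f)))
      (trans (sym (cong ψ⁻¹ (nat-dom f (ψ⁻¹ k))))
        (cong ψ⁻¹ (cong (C._∘ f) (ε k))))

record Graph (a b : Level) : Set (lsuc (a ⊔ b)) where
  field
    Γ₀ : Set a
    Γ₁ : Γ₀ → Γ₀ → Set b

record Diagram (Γ : Graph a b) (C : WildCat o h) : Set (a ⊔ b ⊔ o ⊔ h) where
  open Graph Γ
  open WildCat C
  field
    obj : Γ₀ → Ob
    mor : ∀ {i j} → Γ₁ i j → hom (obj i) (obj j)

record Cocone {Γ : Graph a b} {C : WildCat o h} (F : Diagram Γ C) : Set (a ⊔ b ⊔ o ⊔ h) where
  open Graph Γ
  open WildCat C
  open Diagram F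
  field
    tip : Ob
    leg : ∀ i → hom (obj i) tip
    tri : ∀ {i j} (g : Γ₁ i j) → leg j ∘ mor g ≡ leg i

module _ {C : WildCat o h} {D : WildCat o′ h′}
         {L : WildFunctor C D} {R : WildFunctor D C} (adj : WildAdjunction L R)
         {Γ : Graph a b} {F : Diagram Γ C} (𝒦 : Cocone F) where

  private
    module C = WildCat C
    module D = WildCat D
    module L = WildFunctor L
  open Graph Γ
  open Diagram F
  open Cocone 𝒦
  open WildAdjunction adj

  L-tri : ∀ {i j} (g : Γ₁ i j) → L.F₁ (leg j) D.∘ L.F₁ (mor g) ≡ L.F₁ (leg i)
  L-tri {i} {j} g = trans (L.F-∘ (leg j) (mor g)) (cong L.F₁ (tri g))

  module _ {Y : D.Ob} (h : D.hom (L.F₀ tip) Y) where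

    Q : ∀ i → ψ⁻¹ (ψ h C.∘ leg i) ≡ h D.∘ L.F₁ (leg i)
    Q i = trans (cong ψ⁻¹ (nat-dom (leg i) h)) (η (h D.∘ L.F₁ (leg i)))

    EDGE : ∀ {i j} → Γ₁ i j → Set h′
    EDGE {i} {j} g =
      trans (nat-dom~ (mor g) (ψ h C.∘ leg j))
        (trans (cong ψ⁻¹ (trans (C.assoc (ψ h) (leg j) (mor g))
                                (cong (ψ h C.∘_) (tri g))))
          (Q i))
      ≡
      trans (cong (D._∘ L.F₁ (mor g)) (Q j))
        (trans (D.assoc h (L.F₁ (leg j)) (L.F₁ (mor g)))
          (cong (h D.∘_) (L-tri g)))

module _ (𝕊 : Circle) where
  open Circle 𝕊

  S¹∙ : Pointed 0ℓ
  S¹∙ = S¹ , base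

  module Example {K : Pointed ℓ} (e : S¹∙ ≃∙ Ω K) where

    private
      module e = _≃_ (proj₁ e)
      e₀ : e.to base ≡ refl
      e₀ = proj₂ e

    infixl 7 _•_

    _•_ : S¹ → S¹ → S¹
    x • y = e.from (trans (e.to x) (e.to y))

    -- The left unit law of `trans` is definitional, hence contributes no path.
    •-unitˡ : ∀ x → base • x ≡ x
    •-unitˡ x =
      trans (cong e.from (cong (λ p → trans p (e.to x)) e₀)) (e.left-inverse-of x)

    •-unitʳ : ∀ x → x • base ≡ x
    •-unitʳ x =
      trans (cong e.from (trans (cong (trans (e.to x)) e₀) (trans-reflʳ (e.to x))))
        (e.left-inverse-of x)

    •-assoc : ∀ x y z → (x • y) • z ≡ x • (y • z)
    •-assoc x y z = cong e.from
      (trans (cong (λ p → trans p (e.to z)) (e.right-inverse-of (trans (e.to x) (e.to y))))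
        (trans (trans-assoc (e.to x))
          (cong (trans (e.to x)) (sym (e.right-inverse-of (trans (e.to y) (e.to z)))))))

    -- 𝖫 l is the image of loop under x ↦ x • l, pointed (S¹,base) → (S¹,l) by
    -- the left unit law.
    𝖫 : (l : S¹) → l ≡ l
    𝖫 l = Ω-map (_• l) (•-unitˡ l) loop

    ℰ : WildCat 0ℓ 0ℓ
    ℰ = record
      { Ob    = ⊤
      ; hom   = λ _ _ → S¹
      ; idn   = λ _ → base
      ; _∘_   = λ g f → f • g
      ; unitˡ = •-unitʳ
      ; unitʳ = •-unitˡ
      ; assoc = λ f g h → sym (•-assoc h g f)
      }

    Λ : WildFunctor ℰ ℰ
    Λ = record
      { F₀   = λ X → X
      ; F₁   = λ f → f
      ; F-∘  = λ g f → 𝖫 (WildCat._∘_ ℰ g f)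
      ; F-id = λ _ → refl
      }

    Λ⊣Λ : WildAdjunction Λ Λ
    Λ⊣Λ = record
      { equiv   = λ _ _ → id≃ S¹
      ; nat-cod = λ _ _ → refl
      ; nat-dom = λ _ _ → refl
      }

{-# OPTIONS --without-K #-}

-- As ψ is the identity and nat-dom is refl, the paths Q and nat-dom~ are trivial,
-- so EDGE reduces to α · (K • base) = α · (𝖫 l • base) · (K • base) and hence to
-- 𝖫 l • base = refl, where α is the associator.  Right translations are
-- equivalences, so this forces loop = refl, and then every type would be a set,
-- contradicting univalence applied to the negation on the booleans.

module Submission where

open import Defs
open import Data.Bool.Base using (Bool; true; false; not)
open import Data.Product.Base using (proj₁; proj₂)
open import Level using (Level)
open import Relation.Binary.PropositionalEquality
open import Relation.Nullary using (¬_)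
open BookHoTT using (univalence; circle; truncation)

private
  variable
    a b : Level
    A : Set a
    B : Set b
    x y z : A

trans-cancelˡ : (p : x ≡ y) {q r : y ≡ z} → trans p q ≡ trans p r → q ≡ r
trans-cancelˡ refl q≡r = q≡r

trans-cancelʳ-refl : (p : x ≡ x) (q : x ≡ y) → q ≡ trans p q → p ≡ refl
trans-cancelʳ-refl p refl q≡pq = trans (sym (trans-reflʳ p)) (sym q≡pq)

retract-path : {f : A → B} (g : B → A) (g∘f≗id : ∀ x → g (f x) ≡ x) (p : x ≡ y) →
               trans (sym (g∘f≗id x)) (trans (cong g (cong f p)) (g∘f≗id y)) ≡ p
retract-path {x = x} g g∘f≗id refl = trans-symˡ (g∘f≗id x)

-- Conjugating `cong g (cong f p)` by the homotopy `g∘f≗id` gives back `p`, so `p` is determined by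
-- `cong f p`.
cong≡refl⇒≡refl : {f : A → B} (g : B → A) → (∀ x → g (f x) ≡ x) →
                  (p : x ≡ x) → cong f p ≡ refl → p ≡ refl
cong≡refl⇒≡refl {x = x} {f = f} g g∘f≗id p fp≡refl = begin
  p
    ≡⟨ retract-path g g∘f≗id p ⟨
  trans (sym (g∘f≗id x)) (trans (cong g (cong f p)) (g∘f≗id x))
    ≡⟨ cong (λ q → trans (sym (g∘f≗id x)) (trans (cong g q) (g∘f≗id x))) fp≡refl ⟩
  trans (sym (g∘f≗id x)) (g∘f≗id x)
    ≡⟨ trans-symˡ (g∘f≗id x) ⟩
  refl ∎
  where open ≡-Reasoning

-- Leaving the endpoint `y` free lets `f₀` be contracted, and with it the conjugation in `Ω-map`.
Ω-map≡refl⇒cong≡refl : (f : A → B) (f₀ : f x ≡ y) (p : x ≡ x) →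
                       Ω-map f f₀ p ≡ refl → cong f p ≡ refl
Ω-map≡refl⇒cong≡refl f refl p Ωp≡refl = trans (sym (trans-reflʳ (cong f p))) Ωp≡refl

not≃ : Bool ≃ Bool
not≃ = record
  { to               = not
  ; from             = not
  ; left-inverse-of  = λ { true → refl ; false → refl }
  ; right-inverse-of = λ { true → refl ; false → refl }
  ; left-right       = λ { true → refl ; false → refl }
  }

module _ (univ : Univalence) where
  private
    idtoeqv-isEquiv = univ Bool Bool
    module U = _≃_ (proj₁ idtoeqv-isEquiv)

  not-path : Bool ≡ Bool
  not-path = U.from not≃

  idtoeqv-not-path : idtoeqv not-path ≡ not≃
  idtoeqv-not-path =
    trans (cong (λ f → f not-path) (sym (proj₂ idtoeqv-isEquiv))) (U.right-inverse-of not≃)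

  not-path≢refl : ¬ not-path ≡ refl
  not-path≢refl p≡refl
    -- Transport along `refl` fixes `true`, while transport along `not-path` sends it to `false`.
    with () ← trans (cong (λ p → _≃_.to (idtoeqv p) true) (sym p≡refl))
                    (cong (λ e → _≃_.to e true) idtoeqv-not-path)

subst-const : (p : x ≡ y) (c : B) → subst (λ _ → B) p c ≡ c
subst-const refl c = refl

-- The hypothesis `computes` is the computation rule `ind-loop` in the constant
-- family at B, with the loop generalised so that it can be contracted.
constant-loop-trivial : (f : A → B) {c : B} (p : x ≡ x) (f₀ : f x ≡ c) (q : c ≡ c) →
  (computes : trans (dcong f p) f₀
                ≡ trans (cong (subst (λ _ → B) p) f₀) (trans (subst-const p c) q)) →
  p ≡ refl → q ≡ refl
constant-loop-trivial f _ refl q computes refl = sym computes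

module _ (𝕊 : Circle) where
  open Circle 𝕊

  loop≡refl⇒loops-trivial : loop ≡ refl → (q : x ≡ x) → q ≡ refl
  loop≡refl⇒loops-trivial {x = c} loop≡refl q =
    constant-loop-trivial (ind _ c l) loop (ind-base _ c l) q (ind-loop _ c l) loop≡refl
    -- With this `l`, the map out of the circle sends `loop` to `q`, up to conjugation by
    -- `ind-base`.
    where l = trans (subst-const loop c) q

  loop≢refl : Univalence → ¬ loop ≡ refl
  loop≢refl univ loop≡refl =
    -- The collapse of loops is applied to the universe, at the point `Bool`.
    not-path≢refl univ (loop≡refl⇒loops-trivial loop≡refl (not-path univ))

  module _ {ℓ} {K : Pointed ℓ} (e : S¹∙ 𝕊 ≃∙ Ω K) where
    open Example 𝕊 e
    private module e = _≃_ (proj₁ e)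

    infixl 7 _/_

    -- Right division for the group structure carried over from the loops of `K`; it undoes right
    -- translation.
    _/_ : S¹ → S¹ → S¹
    y / l = e.from (trans (e.to y) (sym (e.to l)))

    •-/ : ∀ x l → (x • l) / l ≡ x
    •-/ x l = begin
      e.from (trans (e.to (x • l)) (sym (e.to l)))
        ≡⟨ cong (λ p → e.from (trans p (sym (e.to l)))) (e.right-inverse-of _) ⟩
      e.from (trans (trans (e.to x) (e.to l)) (sym (e.to l)))
        ≡⟨ cong e.from (trans-assoc (e.to x)) ⟩
      e.from (trans (e.to x) (trans (e.to l) (sym (e.to l))))
        ≡⟨ cong (λ p → e.from (trans (e.to x) p)) (trans-symʳ (e.to l)) ⟩
      e.from (trans (e.to x) refl)
        ≡⟨ cong e.from (trans-reflʳ (e.to x)) ⟩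
      e.from (e.to x)
        ≡⟨ e.left-inverse-of x ⟩
      x ∎
      where open ≡-Reasoning

    cong-•≡refl⇒≡refl : ∀ l (p : x ≡ x) → cong (_• l) p ≡ refl → p ≡ refl
    cong-•≡refl⇒≡refl l = cong≡refl⇒≡refl (_/ l) (λ x → •-/ x l)

    𝖫≡refl⇒loop≡refl : ∀ l → 𝖫 l ≡ refl → loop ≡ refl
    𝖫≡refl⇒loop≡refl l 𝖫≡refl =
      cong-•≡refl⇒≡refl l loop (Ω-map≡refl⇒cong≡refl (_• l) (•-unitˡ l) loop 𝖫≡refl)

    -- The composition law of `Λ` enters `EDGE` only through `L-tri`, on the right-hand side, so
    -- nothing on the left can compensate for it.
    EDGE⇒𝖫≡refl : ∀ {a b} {Γ : Graph a b} {F : Diagram Γ ℰ} (𝒦 : Cocone F) →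
      ∀ {i j} (g : Graph.Γ₁ Γ i j) → EDGE Λ⊣Λ 𝒦 base g →
      𝖫 (Diagram.mor F g • Cocone.leg 𝒦 j) ≡ refl
    EDGE⇒𝖫≡refl {F = F} 𝒦 {j = j} g edge =
      cong-•≡refl⇒≡refl base (𝖫 l)
        (trans-cancelʳ-refl (cong (_• base) (𝖫 l)) K•base
          (trans-cancelˡ α (begin
            trans α K•base
              -- `nat-dom~` and both `Q` paths compute to `refl`; what remains of `ψ⁻¹` is `cong` of
              -- the identity function. As `h` is `base`, post-composition with it is `_• base`.
              ≡⟨ trans (trans-reflʳ _) (cong-id _) ⟨
            trans (cong (λ k → k) (trans α K•base)) refl
              ≡⟨ edge ⟩
            trans α (cong (_• base) (trans (𝖫 l) (cong (λ k → k) (tri g))))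
              ≡⟨ cong (λ p → trans α (cong (_• base) (trans (𝖫 l) p))) (cong-id (tri g)) ⟩
            trans α (cong (_• base) (trans (𝖫 l) (tri g)))
              ≡⟨ cong (trans α) (trans-cong (𝖫 l)) ⟨
            trans α (trans (cong (_• base) (𝖫 l)) K•base) ∎)))
      where
      open ≡-Reasoning
      open Diagram F using (mor)
      open Cocone 𝒦 using (leg; tri)
      l = mor g • leg j
      α = WildCat.assoc ℰ base (leg j) (mor g)
      K•base = cong (_• base) (tri g)

mainTheorem3 : (H : BookHoTT) →
    ∀ {ℓ} (K : Pointed ℓ) → IsK⟨ℤ,2⟩ (truncation H) K →
    (e : S¹∙ (circle H) ≃∙ Ω K) →
    let open Example (circle H) e in
    ∀ {a b} (Γ : Graph a b) (F : Diagram Γ ℰ) (𝒦 : Cocone F) →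
    ∀ {i j} (g : Graph.Γ₁ Γ i j) →
    ¬ EDGE Λ⊣Λ 𝒦 (WildCat.idn ℰ (Cocone.tip 𝒦)) g
mainTheorem3 H K _ e Γ F 𝒦 g edge =
  loop≢refl (circle H) (univalence H)
    (𝖫≡refl⇒loop≡refl (circle H) e _ (EDGE⇒𝖫≡refl (circle H) e 𝒦 g edge))
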